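{- If $G$ is a connected perfect graph with $\alpha(G) \geq 4$, then $c(G) < \alpha(G)$.
   Context: All graphs are finite and simple. $\alpha(G)$ is the independence number of $G$. A graph $G$ is perfect if every induced subgraph $H$ of $G$ satisfies $\chi(H)=\omega(H)$ (chromatic number equals clique number). The Cops and Robbers game on $G$: first $m$ cops are placed on vertices (possibly sharing vertices), then the robber is placed on a vertex; players alternate turns starting with the cops; on a turn each cop (resp. the robber) moves to an adjacent vertex or stays. The cops win if after finitely many moves a cop occupies the robber's vertex; otherwise the robber wins. The cop number $c(G)$ is the least $m$ such that $m$ cops can always win. -}

module Defs where

open import Data.Nat using (ℕ; _≤_)
open import Data.Bool using (Bool; true; false)
open import Data.Fin using (Fin)
open import Data.Fin.Subset using (Subset; _∈_; ∣_∣)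
open import Data.Product using (Σ; ∃; _×_)
open import Data.Sum using (_⊎_)
open import Relation.Binary.PropositionalEquality using (_≡_; _≢_)

record Graph : Set where
  field
    n     : ℕ
    adj   : Fin n → Fin n → Bool
    sym   : ∀ u v → adj u v ≡ adj v u
    irrefl : ∀ v → adj v v ≡ false

open Graph public

Adj : (G : Graph) → Fin (n G) → Fin (n G) → Set
Adj G u v = adj G u v ≡ true

data Reach (G : Graph) : Fin (n G) → Fin (n G) → Set where
  here  : ∀ {v} → Reach G v v
  there : ∀ {u w v} → Adj G u w → Reach G w v → Reach G u v

Connected : Graph → Set
Connected G = ∀ u v → Reach G u v

IsIndependent : (G : Graph) → Subset (n G) → Set
IsIndependent G S = ∀ u v → u ∈ S → v ∈ S → adj G u v ≡ false

IsIndependenceNumber : Graph → ℕ → Set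
IsIndependenceNumber G k =
  (Σ (Subset (n G)) λ S → IsIndependent G S × ∣ S ∣ ≡ k)
  × (∀ S → IsIndependent G S → ∣ S ∣ ≤ k)

IsCliqueIn : (G : Graph) → Subset (n G) → Subset (n G) → Set
IsCliqueIn G S K =
  (∀ v → v ∈ K → v ∈ S) × (∀ u v → u ∈ K → v ∈ K → u ≢ v → Adj G u v)

IsCliqueNumberOf : (G : Graph) → Subset (n G) → ℕ → Set
IsCliqueNumberOf G S k =
  (Σ (Subset (n G)) λ K → IsCliqueIn G S K × ∣ K ∣ ≡ k)
  × (∀ K → IsCliqueIn G S K → ∣ K ∣ ≤ k)

ProperColouring : (G : Graph) → Subset (n G) → ℕ → Set
ProperColouring G S k =
  Σ ((v : Fin (n G)) → v ∈ S → Fin k) λ c →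
    ∀ u v (u∈S : u ∈ S) (v∈S : v ∈ S) → Adj G u v → c u u∈S ≢ c v v∈S

IsChromaticNumberOf : (G : Graph) → Subset (n G) → ℕ → Set
IsChromaticNumberOf G S k =
  ProperColouring G S k × (∀ j → ProperColouring G S j → k ≤ j)

Perfect : Graph → Set
Perfect G = ∀ (S : Subset (n G)) →
  Σ ℕ λ k → IsCliqueNumberOf G S k × IsChromaticNumberOf G S k

Config : Graph → ℕ → Set
Config G m = Fin m → Fin (n G)

Step : (G : Graph) → Fin (n G) → Fin (n G) → Set
Step G u v = u ≡ v ⊎ Adj G u v

CopsMove : (G : Graph) {m : ℕ} → Config G m → Config G m → Set
CopsMove G cs cs' = ∀ i → Step G (cs i) (cs' i)

Caught : (G : Graph) {m : ℕ} → Config G m → Fin (n G) → Set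
Caught G cs r = ∃ λ i → cs i ≡ r

-- Positions from which the cops can force a capture in finitely many moves
-- (inductive = well-founded attractor).
-- CopTurn  cs r : cops to move, cops at cs, robber at r (not yet caught).
-- RobTurn  cs r : robber to move.
data CopTurn (G : Graph) {m : ℕ} (cs : Config G m) (r : Fin (n G)) : Set
data RobTurn (G : Graph) {m : ℕ} (cs : Config G m) (r : Fin (n G)) : Set

data CopTurn G {m} cs r where
  copMove : (cs' : Config G m) → CopsMove G cs cs' →
            (Caught G cs' r ⊎ RobTurn G cs' r) → CopTurn G cs r

data RobTurn G {m} cs r where
  robMove : (∀ r' → Step G r r' → Caught G cs r' ⊎ CopTurn G cs r') →
            RobTurn G cs r

CopsWin : Graph → ℕ → Set
CopsWin G m = Σ (Config G m) λ cs →
  ∀ r → Caught G cs r ⊎ CopTurn G cs r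

{-# OPTIONS --safe #-}
module Submission where

-- By Lovász's weak perfect graph theorem the vertices of G split into α(G) cliques ("classes").
-- One cop per class but one confines the robber to the remaining class. Suppose first that there is
-- an induced path y - z - b through three different classes. The cops start at y, z and in all
-- further classes except that of b, and shift y → z → b: a robber escaping into the class of y
-- would complete an induced C₅, so he is trapped. If there is no such path, adjacency between
-- different classes is transitive. By connectivity some class has edges to two others; the robber is
-- confined to it, and a cop enters it along one of these edges while another cop moves to a
-- neighbour of the robber in a different class, which by transitivity covers the entering cop's
-- former class.
--
-- The weak perfect graph theorem and the absence of induced C₅ both follow from a weighted form of
-- perfection: if every clique has weight at most m, then m independent sets cover each vertex as
-- often as its weight demands.

open import Defs renaming (sym to adj-sym)
import Algebra.Properties.Semiring.Sum as Sum
open import Data.Bool using (true; false; if_then_else_)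
import Data.Bool.Properties as Bool
open import Data.Empty using (⊥-elim)
open import Data.Fin using (Fin; zero; suc; punchIn; punchOut; inject≤; funToFin; finToFun)
open import Data.Fin.Properties as Fin using (_≟_; any?; all?; punchIn-punchOut; finToFun-funToFin; ¬∀⟶∃¬)
open import Data.Fin.Subset using (Subset; _∈_; _∉_; _⊆_; ∣_∣; _∩_; ∁; ⁅_⁆; ⊥; ⊤; inside; outside)
open import Data.Fin.Subset.Properties
open import Data.Nat hiding (_≟_)
open import Data.Nat.Properties as ℕ hiding (_≟_)
open import Data.Nat.Solver using (module +-*-Solver)
open import Data.Product using (Σ; ∃; _×_; _,_; proj₁; proj₂)
open import Data.Sum using (inj₁; inj₂)
open import Data.Vec as Vec using ([]; _∷_; lookup; tabulate)
open import Data.Vec.Properties using ([]=⇒lookup; lookup⇒[]=; lookup∘tabulate)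
open import Function using (_∘_)
open import Relation.Binary.PropositionalEquality hiding ([_])
open import Relation.Nullary using (¬_; Dec; yes; no; does; contradiction)
open import Relation.Nullary.Decidable using (_×-dec_; _⊎-dec_; _→-dec_; ¬?; decidable-stable; dec-true)
open Sum +-*-semiring using (sum; sum-cong-≗; sum-remove; ∑-comm; ∑-distrib-+; *-distribˡ-sum)

-- Sums and indicators

∑-mono-≤ : ∀ {n} {f g : Fin n → ℕ} → (∀ i → f i ≤ g i) → sum f ≤ sum g
∑-mono-≤ {zero}  f≤g = z≤n
∑-mono-≤ {suc n} f≤g = +-mono-≤ (f≤g zero) (∑-mono-≤ (f≤g ∘ suc))

∑-mono-< : ∀ {n} {f g : Fin n → ℕ} → (∀ i → f i ≤ g i) → ∀ k → f k < g k → sum f < sum g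
∑-mono-< f≤g zero    fk<gk = +-mono-<-≤ fk<gk (∑-mono-≤ (f≤g ∘ suc))
∑-mono-< f≤g (suc k) fk<gk = +-mono-≤-< (f≤g zero) (∑-mono-< (f≤g ∘ suc) k fk<gk)

∑-const : ∀ n c → sum {n} (λ _ → c) ≡ n * c
∑-const zero    c = refl
∑-const (suc n) c = cong (c +_) (∑-const n c)

∑-≤-const : ∀ {n} {f : Fin n → ℕ} c → (∀ i → f i ≤ c) → sum f ≤ n * c
∑-≤-const {n} c f≤c = ≤-trans (∑-mono-≤ f≤c) (≤-reflexive (∑-const n c))

term≤∑ : ∀ {n} (f : Fin n → ℕ) i → f i ≤ sum f
term≤∑ f zero    = m≤m+n _ _
term≤∑ f (suc i) = ≤-trans (term≤∑ (f ∘ suc) i) (m≤n+m _ _)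

∑-pos⇒∃ : ∀ {n} (f : Fin n → ℕ) → 0 < sum f → ∃ λ i → 0 < f i
∑-pos⇒∃ {suc n} f 0<∑ with f zero in eq
... | suc _ = zero , subst (0 <_) (sym eq) (s≤s z≤n)
... | zero  = let i , 0<fi = ∑-pos⇒∃ (f ∘ suc) 0<∑ in suc i , 0<fi

∑-unique≤1 : ∀ {n} (f : Fin n → ℕ) → (∀ i → f i ≤ 1) →
             (∀ i j → 0 < f i → 0 < f j → i ≡ j) → sum f ≤ 1
∑-unique≤1 {zero}  f f≤1 uniq = z≤n
∑-unique≤1 {suc n} f f≤1 uniq with sum (f ∘ suc) in eq
... | zero  = subst (_≤ 1) (sym (+-identityʳ (f zero))) (f≤1 zero)
... | suc s with ∑-pos⇒∃ (f ∘ suc) (subst (0 <_) (sym eq) (s≤s z≤n)) | f zero in eq₀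
...   | i , 0<fi | suc _ = contradiction (uniq zero (suc i) (subst (0 <_) (sym eq₀) (s≤s z≤n)) 0<fi) λ ()
...   | _        | zero  = subst (_≤ 1) eq
        (∑-unique≤1 (f ∘ suc) (f≤1 ∘ suc) λ i j p q → Fin.suc-injective (uniq (suc i) (suc j) p q))

𝟙 : ∀ {p} {P : Set p} → Dec P → ℕ
𝟙 P? = if does P? then 1 else 0

𝟙≤1 : ∀ {p} {P : Set p} (P? : Dec P) → 𝟙 P? ≤ 1
𝟙≤1 (yes _) = ≤-refl
𝟙≤1 (no _)  = z≤n

𝟙-yes : ∀ {p} {P : Set p} (P? : Dec P) → P → 𝟙 P? ≡ 1
𝟙-yes (yes _) _ = refl
𝟙-yes (no ¬p) p = contradiction p ¬p

𝟙-no : ∀ {p} {P : Set p} (P? : Dec P) → ¬ P → 𝟙 P? ≡ 0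
𝟙-no (yes p) ¬p = contradiction p ¬p
𝟙-no (no _)  _  = refl

𝟙-pos : ∀ {p} {P : Set p} (P? : Dec P) → 0 < 𝟙 P? → P
𝟙-pos (yes p) _ = p

δ : ∀ {n} → Fin n → Fin n → ℕ
δ x v = 𝟙 (x ≟ v)

χ : ∀ {n} → Subset n → Fin n → ℕ
χ S v = 𝟙 (v ∈? S)

∑-δ : ∀ {n} (g : Fin n → ℕ) x → sum (λ v → g v * δ x v) ≡ g x
∑-δ {suc n} g zero = begin
  g zero * 1 + sum (λ v → g (suc v) * 0) ≡⟨ cong₂ _+_ (*-identityʳ _) (sum-cong-≗ (λ v → *-zeroʳ (g (suc v)))) ⟩
  g zero + sum {n} (λ _ → 0)             ≡⟨ cong (g zero +_) (∑-const n 0) ⟩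
  g zero + n * 0                         ≡⟨ cong (g zero +_) (*-zeroʳ n) ⟩
  g zero + 0                             ≡⟨ +-identityʳ _ ⟩
  g zero                                 ∎
  where open ≡-Reasoning
∑-δ g (suc x) = trans (cong (_+ sum (λ v → g (suc v) * δ x v)) (*-zeroʳ (g zero))) (∑-δ (g ∘ suc) x)

∣∣≡∑χ : ∀ {n} (S : Subset n) → ∣ S ∣ ≡ sum (χ S)
∣∣≡∑χ []            = refl
∣∣≡∑χ (inside ∷ S)  = cong suc (∣∣≡∑χ S)
∣∣≡∑χ (outside ∷ S) = ∣∣≡∑χ S

χ-∩ : ∀ {n} (S T : Subset n) v → χ (S ∩ T) v ≡ χ S v * χ T v
χ-∩ S T v with v ∈? S | v ∈? T
... | yes p | yes q = 𝟙-yes (v ∈? (S ∩ T)) (x∈p∩q⁺ (p , q))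
... | yes p | no ¬q = 𝟙-no (v ∈? (S ∩ T)) (¬q ∘ proj₂ ∘ x∈p∩q⁻ S T)
... | no ¬p | _     = 𝟙-no (v ∈? (S ∩ T)) (¬p ∘ proj₁ ∘ x∈p∩q⁻ S T)

-- `ProperColouring` colours a vertex together with a proof of membership; this makes the colour
-- depend on the vertex alone.
∈-irrelevant : ∀ {n} {S : Subset n} {v} (p q : v ∈ S) → p ≡ q
∈-irrelevant Vec.here      Vec.here      = refl
∈-irrelevant (Vec.there p) (Vec.there q) = cong Vec.there (∈-irrelevant p q)

χ-*-< : ∀ {n} (K : Subset n) {v a b} → v ∈ K → a < b → χ K v * a < χ K v * b
χ-*-< K {v} v∈K a<b rewrite 𝟙-yes (v ∈? K) v∈K = *-monoʳ-< 1 a<b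

decSubset : ∀ {n} {P : Fin n → Set} → (∀ v → Dec (P v)) → Subset n
decSubset P? = tabulate (does ∘ P?)

module _ {n} {P : Fin n → Set} (P? : ∀ v → Dec (P v)) where

  ∈-decSubset⁺ : ∀ {v} → P v → v ∈ decSubset P?
  ∈-decSubset⁺ {v} p = lookup⇒[]= v _ (trans (lookup∘tabulate _ v) (dec-true (P? v) p))

  ∈-decSubset⁻ : ∀ {v} → v ∈ decSubset P? → P v
  ∈-decSubset⁻ {v} v∈ with P? v | trans (sym (lookup∘tabulate (does ∘ P?) v)) ([]=⇒lookup v∈)
  ... | yes p | _ = p

adj-reverse : ∀ G {u v b} → adj G u v ≡ b → adj G v u ≡ b
adj-reverse G = trans (adj-sym G _ _)

IsClique : (G : Graph) → Subset (n G) → Set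
IsClique G K = ∀ u v → u ∈ K → v ∈ K → u ≢ v → Adj G u v

singleton-clique : ∀ G x → IsClique G ⁅ x ⁆
singleton-clique G x u v u∈ v∈ u≢v = contradiction (trans (x∈⁅y⁆⇒x≡y x u∈) (sym (x∈⁅y⁆⇒x≡y x v∈))) u≢v

weight : ∀ {n} → Subset n → (Fin n → ℕ) → ℕ
weight K w = sum λ v → χ K v * w v

weight-mono : ∀ {n} (K : Subset n) {w w′ : Fin n → ℕ} → (∀ v → w v ≤ w′ v) → weight K w ≤ weight K w′
weight-mono K w≤w′ = ∑-mono-≤ λ v → *-monoʳ-≤ (χ K v) (w≤w′ v)

weight-∑ : ∀ {n m} (K : Subset n) (f : Fin m → Fin n → ℕ) →
           weight K (λ v → sum λ i → f i v) ≡ sum λ i → weight K (f i)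
weight-∑ K f = trans (sum-cong-≗ λ v → *-distribˡ-sum (χ K v) (λ i → f i v)) (∑-comm λ v i → χ K v * f i v)

-- Lovász's replication lemma

module WeightedColouring (G : Graph) where

  private
    V = Fin (n G)

  clique∩independent≤1 : ∀ {K S} → IsClique G K → IsIndependent G S → weight K (χ S) ≤ 1
  clique∩independent≤1 {K} {S} clique indep =
    ∑-unique≤1 _ (λ v → *-mono-≤ (𝟙≤1 (v ∈? K)) (𝟙≤1 (v ∈? S))) unique
    where
    both : ∀ v → 0 < χ K v * χ S v → v ∈ K × v ∈ S
    both v pos with v ∈? K | v ∈? S
    ... | yes p | yes q = p , q
    unique : ∀ u v → 0 < χ K u * χ S u → 0 < χ K v * χ S v → u ≡ v
    unique u v pu pv with u ≟ v
    ... | yes u≡v = u≡v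
    ... | no  u≢v with both u pu | both v pv
    ...   | u∈K , u∈S | v∈K , v∈S =
            contradiction (trans (sym (clique u v u∈K v∈K u≢v)) (indep u v u∈S v∈S)) λ ()

  CliqueBound : (V → ℕ) → ℕ → Set
  CliqueBound w m = ∀ K → IsClique G K → weight K w ≤ m

  -- Amounts to an `m`-colouring of the graph in which each `v` is replaced by a clique of `w v`
  -- copies; weights avoid building that graph. A vertex may be covered more often than its weight
  -- demands.
  record Multicolouring (w : V → ℕ) (m : ℕ) : Set where
    field
      class       : Fin m → Subset (n G)
      independent : ∀ i → IsIndependent G (class i)
      covers      : ∀ v → w v ≤ sum λ i → χ (class i) v

  open Multicolouring

  -- Such a `w` is the indicator of its support, where a clique weighs its own size. By perfection
  -- the support is coloured with as many colours as its largest clique has vertices, hence with at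
  -- most `m`.
  multicolour-01 : Perfect G → ∀ {w m} → (∀ v → w v ≤ 1) → CliqueBound w m → Multicolouring w m
  multicolour-01 perfect {w} {m} w≤1 bound with perfect (decSubset λ v → 0 <? w v)
  ... | k , ((K , (K⊆supp , clique) , ∣K∣≡k) , _) , ((colour , proper) , _) = record
    { class       = λ i → decSubset (coloured? i)
    ; independent = indep
    ; covers      = cover }
    where
    supp = decSubset λ v → 0 <? w v
    k≤m : k ≤ m
    k≤m = begin
      k          ≡⟨ ∣K∣≡k ⟨
      ∣ K ∣      ≡⟨ ∣∣≡∑χ K ⟩
      sum (χ K)  ≤⟨ ∑-mono-≤ χK≤ ⟩
      weight K w ≤⟨ bound K clique ⟩
      m          ∎
      where
      open ≤-Reasoning
      χK≤ : ∀ v → χ K v ≤ χ K v * w v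
      χK≤ v with v ∈? K
      ... | yes v∈K = subst (1 ≤_) (sym (+-identityʳ (w v))) (∈-decSubset⁻ (λ v → 0 <? w v) (K⊆supp v v∈K))
      ... | no  _   = z≤n
    Coloured : Fin m → V → Set
    Coloured i v = Σ (v ∈ supp) λ v∈S → inject≤ (colour v v∈S) k≤m ≡ i
    coloured? : ∀ i v → Dec (Coloured i v)
    coloured? i v with v ∈? supp
    ... | no  v∉S = no (v∉S ∘ proj₁)
    ... | yes v∈S with inject≤ (colour v v∈S) k≤m ≟ i
    ...   | yes c≡i = yes (v∈S , c≡i)
    ...   | no  c≢i = no λ (v∈S′ , c≡i) → c≢i (subst (λ p → inject≤ (colour v p) k≤m ≡ i) (∈-irrelevant v∈S′ v∈S) c≡i)
    indep : ∀ i → IsIndependent G (decSubset (coloured? i))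
    indep i u v u∈ v∈ with ∈-decSubset⁻ (coloured? i) u∈ | ∈-decSubset⁻ (coloured? i) v∈ | adj G u v in eq
    ... | _           | _           | false = refl
    ... | u∈S , cu≡i | v∈S , cv≡i | true  = contradiction
      (Fin.inject≤-injective k≤m k≤m _ _ (trans cu≡i (sym cv≡i))) (proper u v u∈S v∈S eq)
    cover : ∀ v → w v ≤ sum λ i → χ (decSubset (coloured? i)) v
    cover v with v ∈? supp
    ... | no  v∉S = ≤-trans (≮⇒≥ (v∉S ∘ ∈-decSubset⁺ (λ v → 0 <? w v))) z≤n
    ... | yes v∈S = begin
      w v                                    ≤⟨ w≤1 v ⟩
      1                                      ≡⟨ 𝟙-yes (v ∈? decSubset (coloured? i)) (∈-decSubset⁺ (coloured? i) (v∈S , refl)) ⟨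
      χ (decSubset (coloured? i)) v          ≤⟨ term≤∑ (λ i → χ (decSubset (coloured? i)) v) i ⟩
      sum (λ i → χ (decSubset (coloured? i)) v) ∎
      where
      open ≤-Reasoning
      i = inject≤ (colour v v∈S) k≤m

  -- Induction step at a vertex `x` of weight at least 2. A colouring for `w₀`, which drops one copy
  -- of `x`, supplies a class `X` through `x`; removing `X` from `w` leaves a weight whose cliques
  -- are bounded by `m`.
  module Replicate {w m x} (2≤wx : 2 ≤ w x) (bound : CliqueBound w (suc m)) where

    w₀ : V → ℕ
    w₀ v = w v ∸ δ x v

    w₀≤w : ∀ v → w₀ v ≤ w v
    w₀≤w v = m∸n≤m (w v) (δ x v)

    w₀+δ : ∀ v → w₀ v + δ x v ≡ w v
    w₀+δ v with x ≟ v
    ... | yes refl = m∸n+n≡m (≤-trans (s≤s z≤n) 2≤wx)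
    ... | no  _    = +-identityʳ _

    ∑w₀ : suc (sum w₀) ≡ sum w
    ∑w₀ = sym (begin
      sum w                        ≡⟨ sum-cong-≗ (λ v → w₀+δ v) ⟨
      sum (λ v → w₀ v + δ x v)     ≡⟨ ∑-distrib-+ w₀ (δ x) ⟩
      sum w₀ + sum (δ x)           ≡⟨ cong (sum w₀ +_) (sum-cong-≗ (λ v → *-identityˡ (δ x v))) ⟨
      sum w₀ + sum (λ v → 1 * δ x v) ≡⟨ cong (sum w₀ +_) (∑-δ (λ _ → 1) x) ⟩
      sum w₀ + 1                   ≡⟨ +-comm _ 1 ⟩
      suc (sum w₀)                 ∎)
      where open ≡-Reasoning

    0<w₀x : 0 < w₀ x
    0<w₀x = subst (λ d → 0 < w x ∸ d) (sym (𝟙-yes (x ≟ x) refl)) (m<n⇒0<n∸m 2≤wx)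

    module _ (M : Multicolouring w₀ (suc m)) where

      private
        found = ∑-pos⇒∃ (λ i → χ (class M i) x) (<-≤-trans 0<w₀x (covers M x))

      i₀ : Fin (suc m)
      i₀ = proj₁ found

      X : Subset (n G)
      X = class M i₀

      x∈X : x ∈ X
      x∈X = 𝟙-pos (x ∈? X) (proj₂ found)

      -- `w₀` has already lowered `x`, so only the rest of `X` is subtracted.
      w₁ : V → ℕ
      w₁ v = w₀ v ∸ (χ X v ∸ δ x v)

      w₁≤w₀ : ∀ v → w₁ v ≤ w₀ v
      w₁≤w₀ v = m∸n≤m (w₀ v) (χ X v ∸ δ x v)

      -- A clique avoiding X (up to weight 0) meets only the m other classes.
      bound₁ : CliqueBound w₁ m
      bound₁ K clique with x ∈? K
      -- The copy of `x` dropped in `w₀` already saves a unit on `K`.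
      ... | yes x∈K = s≤s⁻¹ (begin-strict
        weight K w₁ ≤⟨ weight-mono K w₁≤w₀ ⟩
        weight K w₀ <⟨ ∑-mono-< (λ v → *-monoʳ-≤ (χ K v) (w₀≤w v)) x (χ-*-< K x∈K w₀x<wx) ⟩
        weight K w  ≤⟨ bound K clique ⟩
        suc m       ∎)
        where
        open ≤-Reasoning
        w₀x<wx : w₀ x < w x
        w₀x<wx = ≤-reflexive (trans (+-comm 1 (w₀ x)) (trans (cong (w₀ x +_) (sym (𝟙-yes (x ≟ x) refl))) (w₀+δ x)))
      ... | no x∉K with any? (λ v → (v ∈? K) ×-dec (v ∈? X) ×-dec (0 <? w₀ v))
      -- Here `v` differs from `x`, so subtracting `X` saves a unit on `K`.
      ...   | yes (v , v∈K , v∈X , 0<w₀v) = s≤s⁻¹ (begin-strict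
        weight K w₁ <⟨ ∑-mono-< (λ v → *-monoʳ-≤ (χ K v) (w₁≤w₀ v)) v (χ-*-< K v∈K w₁v<w₀v) ⟩
        weight K w₀ ≤⟨ weight-mono K w₀≤w ⟩
        weight K w  ≤⟨ bound K clique ⟩
        suc m       ∎)
        where
        open ≤-Reasoning
        w₁v<w₀v : w₁ v < w₀ v
        w₁v<w₀v = subst (λ d → w₀ v ∸ d < w₀ v)
          (sym (cong₂ _∸_ (𝟙-yes (v ∈? X) v∈X) (𝟙-no (x ≟ v) λ { refl → x∉K v∈K })))
          (∸-monoʳ-< ≤-refl 0<w₀v)
      ...   | no disjoint = begin
        weight K w₁                                         ≤⟨ weight-mono K w₁≤w₀ ⟩
        weight K w₀                                         ≤⟨ ∑-mono-≤ pointwise ⟩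
        weight K (λ v → sum λ j → χ (class M (punchIn i₀ j)) v) ≡⟨ weight-∑ K (λ j → χ (class M (punchIn i₀ j))) ⟩
        sum (λ j → weight K (χ (class M (punchIn i₀ j))))   ≤⟨ ∑-≤-const 1 (λ j → clique∩independent≤1 clique (independent M (punchIn i₀ j))) ⟩
        m * 1                                               ≡⟨ *-identityʳ m ⟩
        m                                                   ∎
        where
        open ≤-Reasoning
        pointwise : ∀ v → χ K v * w₀ v ≤ χ K v * sum λ j → χ (class M (punchIn i₀ j)) v
        pointwise v with v ∈? K
        ... | no  _   = z≤n
        ... | yes v∈K with v ∈? X
        ...   | yes v∈X = *-monoʳ-≤ 1 (≤-trans (≮⇒≥ λ 0<w₀v → disjoint (v , v∈K , v∈X , 0<w₀v)) z≤n)
        ...   | no  v∉X = *-monoʳ-≤ 1 (≤-trans (covers M v) (≤-reflexive (trans (sum-remove {i = i₀} (λ i → χ (class M i) v))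
                (cong (_+ sum (λ j → χ (class M (punchIn i₀ j)) v)) (𝟙-no (v ∈? X) v∉X)))))

      extend : Multicolouring w₁ m → Multicolouring w (suc m)
      extend N = record
        { class       = λ { zero → X ; (suc i) → class N i }
        ; independent = λ { zero → independent M i₀ ; (suc i) → independent N i }
        ; covers      = λ v → ≤-trans (step v) (+-monoʳ-≤ (χ X v) (covers N v)) }
        where
        step : ∀ v → w v ≤ χ X v + w₁ v
        step v with x ≟ v
        ... | yes refl rewrite 𝟙-yes (x ∈? X) x∈X = m≤n+m∸n (w x) 1
        ... | no  x≢v  = m≤n+m∸n (w v) (χ X v)

  -- `t` bounds the total weight and makes the recursion structural: `w₀` has total weight one less
  -- than `w`, and `w₁` no more than `w₀`.
  multicolour : Perfect G → ∀ t {w m} → sum w ≤ t → CliqueBound w m → Multicolouring w m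
  multicolour perfect t {w} {m} ∑w≤t bound with any? (λ x → 2 ≤? w x)
  ... | no  none = multicolour-01 perfect (λ v → s≤s⁻¹ (≰⇒> λ 2≤wv → none (v , 2≤wv))) bound
  multicolour perfect zero {w} ∑w≤t bound | yes (x , 2≤wx) = contradiction (≤-trans 2≤wx (≤-trans (term≤∑ w x) ∑w≤t)) λ ()
  -- With no colours, the clique consisting of `x` alone would exceed the bound 0.
  multicolour perfect (suc t) {w} {zero} ∑w≤t bound | yes (x , 2≤wx) = contradiction
    (begin-strict
      0                  ≡⟨ *-zeroʳ (χ ⁅ x ⁆ x) ⟨
      χ ⁅ x ⁆ x * 0      <⟨ χ-*-< ⁅ x ⁆ {x} {0} {w x} (x∈⁅x⁆ x) (≤-trans (s≤s z≤n) 2≤wx) ⟩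
      χ ⁅ x ⁆ x * w x    ≤⟨ term≤∑ (λ v → χ ⁅ x ⁆ v * w v) x ⟩
      weight ⁅ x ⁆ w     ≤⟨ bound ⁅ x ⁆ (singleton-clique G x) ⟩
      0                  ∎) λ ()
    where open ≤-Reasoning
  multicolour perfect (suc t) {w} {suc m} ∑w≤t bound | yes (x , 2≤wx) =
    extend M (multicolour perfect t (≤-trans (∑-mono-≤ (w₁≤w₀ M)) ∑w₀≤t) (bound₁ M))
    where
    open Replicate 2≤wx bound
    ∑w₀≤t : sum w₀ ≤ t
    ∑w₀≤t = s≤s⁻¹ (subst (_≤ suc t) (sym ∑w₀) ∑w≤t)
    M : Multicolouring w₀ (suc m)
    M = multicolour perfect t ∑w₀≤t λ K clique → ≤-trans (weight-mono K w₀≤w) (bound K clique)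

-- The weak perfect graph theorem

-- The five inequalities bound the sum by 5/2, and integrality rounds this down. If `x₄` is 0 the
-- others pair up; if it is 1, both its neighbours vanish.
pentagon≤2 : ∀ x₀ x₁ x₂ x₃ x₄ → x₀ + x₁ ≤ 1 → x₁ + x₂ ≤ 1 → x₂ + x₃ ≤ 1 → x₃ + x₄ ≤ 1 → x₄ + x₀ ≤ 1 →
             x₀ + (x₁ + (x₂ + (x₃ + (x₄ + 0)))) ≤ 2
pentagon≤2 x₀ x₁ x₂ x₃ zero p₀₁ _ p₂₃ _ _
  rewrite +-identityʳ x₃ | sym (+-assoc x₀ x₁ (x₂ + x₃)) = +-mono-≤ p₀₁ p₂₃
pentagon≤2 zero x₁ x₂ zero (suc zero) _ p₁₂ _ _ _
  rewrite sym (+-assoc x₁ x₂ 1) = +-monoˡ-≤ 1 p₁₂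
pentagon≤2 x₀ x₁ x₂ (suc x₃) (suc x₄) _ _ _ (s≤s p) _ = contradiction (≤-trans (m≤n+m (suc x₄) x₃) p) λ ()
pentagon≤2 x₀ x₁ x₂ zero (suc (suc x₄)) _ _ _ (s≤s ()) _
pentagon≤2 (suc x₀) x₁ x₂ zero (suc x₄) _ _ _ _ (s≤s p) = contradiction (≤-trans (m≤n+m (suc x₀) x₄) p) λ ()

module _ (G : Graph) (perfect : Perfect G) where

  open WeightedColouring G
  open Multicolouring

  private
    V = Fin (n G)

    -- `IsClique` speaks of distinct vertices only; distinctness of cycle vertices is read off from
    -- a third vertex adjacent to just one of them.
    separated : ∀ {u v w} → Adj G u w → adj G v w ≡ false → u ≢ v
    separated uw ¬vw refl = contradiction (trans (sym uw) ¬vw) λ ()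

  χ+χ≤1 : ∀ {S : Subset (n G)} {u v} → ¬ (u ∈ S × v ∈ S) → χ S u + χ S v ≤ 1
  χ+χ≤1 {S} {u} {v} ¬both with u ∈? S | v ∈? S
  ... | yes p | yes q = contradiction (p , q) ¬both
  ... | yes _ | no  _ = ≤-refl
  ... | no  _ | yes _ = ≤-refl
  ... | no  _ | no  _ = z≤n

  clique-χ : ∀ {K u v} → IsClique G K → u ≢ v → adj G u v ≡ false → χ K u + χ K v ≤ 1
  clique-χ clique u≢v ¬uv = χ+χ≤1 λ (u∈K , v∈K) → contradiction (trans (sym (clique _ _ u∈K v∈K u≢v)) ¬uv) λ ()

  independent-χ : ∀ {S u v} → IsIndependent G S → Adj G u v → χ S u + χ S v ≤ 1
  independent-χ indep uv = χ+χ≤1 λ (u∈S , v∈S) → contradiction (trans (sym uv) (indep _ _ u∈S v∈S)) λ ()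

  -- With weight 1 on the cycle every clique weighs at most 2, so two independent sets would cover
  -- five vertices, yet each contains at most two of them.
  perfect⇒no-C₅ : ∀ {a b c d e} →
    Adj G a b → Adj G b c → Adj G c d → Adj G d e → Adj G e a →
    adj G a c ≡ false → adj G c e ≡ false → adj G e b ≡ false → adj G b d ≡ false → ¬ adj G d a ≡ false
  perfect⇒no-C₅ {a} {b} {c} {d} {e} ab bc cd de ea ¬ac ¬ce ¬eb ¬bd ¬da = <-irrefl refl (begin-strict
      4                                                ≡⟨⟩
      2 * 2                                            <⟨ ≤-refl ⟩
      5 * 1                                            ≡⟨ ∑-const 5 1 ⟨
      sum {5} (λ _ → 1)                                ≤⟨ ∑-mono-≤ covered ⟩
      sum (λ i → sum λ j → χ (class M j) (p i))        ≡⟨ ∑-comm (λ i j → χ (class M j) (p i)) ⟩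
      sum (λ j → sum λ i → χ (class M j) (p i))        ≤⟨ ∑-≤-const 2 (λ j → independent-meets (class M j) (independent M j)) ⟩
      2 * 2                                            ∎)
    where
    open ≤-Reasoning
    p : Fin 5 → V
    -- This order runs round the complementary 5-cycle: consecutive entries are non-adjacent, as the
    -- bound for cliques requires.
    p = lookup (a ∷ c ∷ e ∷ b ∷ d ∷ [])
    w : V → ℕ
    w v = sum λ i → δ (p i) v
    bound : CliqueBound w 2
    bound K clique = begin
      weight K w                    ≡⟨ weight-∑ K (λ i → δ (p i)) ⟩
      sum (λ i → weight K (δ (p i))) ≡⟨ sum-cong-≗ (λ i → ∑-δ (χ K) (p i)) ⟩
      sum (λ i → χ K (p i))         ≤⟨ pentagon≤2 (χ K a) (χ K c) (χ K e) (χ K b) (χ K d)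
        (clique-χ clique (separated (adj-reverse G ea) ¬ce) ¬ac)
        (clique-χ clique (separated (adj-reverse G bc) ¬eb) ¬ce)
        (clique-χ clique (separated (adj-reverse G de) ¬bd) ¬eb)
        (clique-χ clique (separated (adj-reverse G ab) ¬da) ¬bd)
        (clique-χ clique (separated (adj-reverse G cd) ¬ac) ¬da) ⟩
      2                             ∎
    M : Multicolouring w 2
    M = multicolour perfect (sum w) ≤-refl bound
    covered : ∀ i → 1 ≤ sum λ j → χ (class M j) (p i)
    covered i = begin
      1                   ≡⟨ 𝟙-yes (p i ≟ p i) refl ⟨
      δ (p i) (p i)       ≤⟨ term≤∑ (λ k → δ (p k) (p i)) i ⟩
      w (p i)             ≤⟨ covers M (p i) ⟩
      sum (λ j → χ (class M j) (p i)) ∎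
    independent-meets : ∀ S → IsIndependent G S → sum (λ i → χ S (p i)) ≤ 2
    independent-meets S indep = begin
      χ S a + (χ S c + (χ S e + (χ S b + (χ S d + 0))))
        -- Back to the order of the cycle itself, where an independent set contains at most one of
        -- two consecutive vertices.
        ≡⟨ solve 5 (λ a b c d e → (a :+ (c :+ (e :+ (b :+ (d :+ con 0))))) :=
                                  (a :+ (b :+ (c :+ (d :+ (e :+ con 0)))))) refl
             (χ S a) (χ S b) (χ S c) (χ S d) (χ S e) ⟩
      χ S a + (χ S b + (χ S c + (χ S d + (χ S e + 0)))) ≤⟨ pentagon≤2 (χ S a) (χ S b) (χ S c) (χ S d) (χ S e)
        (independent-χ indep ab) (independent-χ indep bc) (independent-χ indep cd) (independent-χ indep de) (independent-χ indep ea) ⟩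
      2 ∎
      where open +-*-Solver

  -- Covering by as many cliques as the independence number

  independent? : ∀ S → Dec (IsIndependent G S)
  independent? S = all? λ u → all? λ v → (u ∈? S) →-dec (v ∈? S) →-dec (adj G u v Bool.≟ false)

  clique? : ∀ K → Dec (IsClique G K)
  clique? K = all? λ u → all? λ v → (u ∈? K) →-dec (v ∈? K) →-dec ¬? (u ≟ v) →-dec (adj G u v Bool.≟ true)

  IndependentIn : Subset (n G) → ℕ → Subset (n G) → Set
  IndependentIn S a A = IsIndependent G A × A ⊆ S × ∣ A ∣ ≡ a

  Disjoint : Subset (n G) → Subset (n G) → Set
  Disjoint A K = ∀ v → v ∈ A → v ∉ K

  -- For `a` the independence number of `S`, the negation says that `K` meets every maximum
  -- independent set of `S`.
  Missed : Subset (n G) → ℕ → Subset (n G) → Set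
  Missed S a K = ∃ λ A → IndependentIn S a A × Disjoint A K

  missed? : ∀ S a K → Dec (Missed S a K)
  missed? S a K = anySubset? λ A →
    (independent? A ×-dec A ⊆? S ×-dec ∣ A ∣ ℕ.≟ a) ×-dec all? λ v → (v ∈? A) →-dec ¬? (v ∈? K)

  -- Subsets are numbered through functions into `Fin 2`, with `zero` for membership, so that sums
  -- can run over all of them.
  subsetAt : Fin (2 ^ n G) → Subset (n G)
  subsetAt t = decSubset λ v → finToFun {2} {n G} t v ≟ zero

  index : Subset (n G) → Fin (2 ^ n G)
  index K = funToFin λ v → if does (v ∈? K) then zero else suc zero

  ∈-index⁺ : ∀ K {v} → v ∈ K → v ∈ subsetAt (index K)
  ∈-index⁺ K {v} v∈K = ∈-decSubset⁺ (λ v → finToFun {2} {n G} (index K) v ≟ zero)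
    (trans (finToFun-funToFin _ v) (cong (if_then zero else suc zero) (dec-true (v ∈? K) v∈K)))

  ∈-index⁻ : ∀ K {v} → v ∈ subsetAt (index K) → v ∈ K
  ∈-index⁻ K {v} v∈ with v ∈? K | trans (sym (finToFun-funToFin _ v)) (∈-decSubset⁻ (λ v → finToFun {2} {n G} (index K) v ≟ zero) v∈)
  ... | yes v∈K | _ = v∈K

  -- Otherwise give each vertex as weight the number of cliques K whose missed set contains it:
  -- cliques have weight below the number N of sets K, but the total weight is N times α.
  hitting-clique : ∀ S a → (∀ A → IsIndependent G A → A ⊆ S → ∣ A ∣ ≤ suc a) →
                   ∃ λ K → IsClique G K × ¬ Missed S (suc a) K
  hitting-clique S a α≤ with anySubset? (λ K → clique? K ×-dec ¬? (missed? S (suc a) K))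
  ... | yes hit = hit
  ... | no none = contradiction total (<⇒≱ (*-monoˡ-< (suc a) pred<))
    where
    N = 2 ^ n G
    instance
      N≢0 : NonZero N
      N≢0 = m^n≢0 2 (n G)
    pred< : pred N < N
    pred< = ≤-reflexive (suc-pred N)
    missed : ∀ K → IsClique G K → Missed S (suc a) K
    missed K clique = decidable-stable (missed? S (suc a) K) λ ¬m → none (K , clique , ¬m)
    chosen : ∀ K → ∃ λ A → IndependentIn S (suc a) A × (IsClique G K → Disjoint A K)
    chosen K with clique? K
    ... | yes clique = let A , A∈ , dis = missed K clique in A , A∈ , λ _ → dis
    -- For a non-clique any independent set of size `suc a` in `S` will do; the empty clique
    -- provides one.
    ... | no ¬clique = let A , A∈ , _ = missed ⊥ (λ _ _ u∈⊥ → ⊥-elim (∉⊥ u∈⊥)) in A , A∈ , λ clique → contradiction clique ¬clique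
    A : Fin N → Subset (n G)
    A t = proj₁ (chosen (subsetAt t))
    w : V → ℕ
    w v = sum λ t → χ (A t) v
    bound : CliqueBound w (pred N)
    bound K clique = suc[m]≤n⇒m≤pred[n] (begin-strict
      weight K w                       ≡⟨ weight-∑ K (λ t → χ (A t)) ⟩
      -- Each chosen set meets `K` at most once, and the one chosen for `K` itself not at all.
      sum (λ t → weight K (χ (A t)))   <⟨ ∑-mono-<
        (λ t → clique∩independent≤1 clique (proj₁ (proj₁ (proj₂ (chosen (subsetAt t))))))
        (index K) (s≤s (≤-reflexive avoid)) ⟩
      sum {N} (λ _ → 1)                ≡⟨ ∑-const N 1 ⟩
      N * 1                            ≡⟨ *-identityʳ N ⟩
      N                                ∎)
      where
      open ≤-Reasoning
      avoids : Disjoint (A (index K)) (subsetAt (index K))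
      avoids = proj₂ (proj₂ (chosen (subsetAt (index K)))) λ u v u∈ v∈ → clique u v (∈-index⁻ K u∈) (∈-index⁻ K v∈)
      zeroes : ∀ v → χ K v * χ (A (index K)) v ≡ 0
      zeroes v with v ∈? K
      ... | no  _   = refl
      ... | yes v∈K = trans (+-identityʳ _) (𝟙-no (v ∈? A (index K)) λ v∈A → avoids v v∈A (∈-index⁺ K v∈K))
      avoid : weight K (χ (A (index K))) ≡ 0
      avoid = trans (sum-cong-≗ zeroes) (trans (∑-const (n G) 0) (*-zeroʳ (n G)))
    M : Multicolouring w (pred N)
    M = multicolour perfect (sum w) ≤-refl bound
    weight-S : ∀ T → weight S (χ T) ≡ ∣ S ∩ T ∣
    weight-S T = sym (trans (∣∣≡∑χ (S ∩ T)) (sum-cong-≗ (χ-∩ S T)))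
    sizes : ∀ t → suc a ≤ weight S (χ (A t))
    sizes t with proj₁ (proj₂ (chosen (subsetAt t)))
    ... | _ , A⊆S , ∣A∣≡ = begin
      suc a                 ≡⟨ ∣A∣≡ ⟨
      ∣ A t ∣               ≤⟨ p⊆q⇒∣p∣≤∣q∣ (λ v∈A → x∈p∩q⁺ (A⊆S v∈A , v∈A)) ⟩
      ∣ S ∩ A t ∣           ≡⟨ weight-S (A t) ⟨
      weight S (χ (A t))    ∎
      where open ≤-Reasoning
    small : ∀ T → IsIndependent G T → weight S (χ T) ≤ suc a
    small T indep = subst (_≤ suc a) (sym (weight-S T))
      (α≤ (S ∩ T) (λ u v u∈ v∈ → indep u v (proj₂ (x∈p∩q⁻ S T u∈)) (proj₂ (x∈p∩q⁻ S T v∈))) (p∩q⊆p S T))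
    -- The weight of `S` counted twice: `N` chosen sets contribute at least `suc a` each, while
    -- `pred N` classes covering that weight contribute at most `suc a` each.
    total : N * suc a ≤ pred N * suc a
    total = begin
      N * suc a                                        ≡⟨ ∑-const N (suc a) ⟨
      sum {N} (λ _ → suc a)                            ≤⟨ ∑-mono-≤ sizes ⟩
      sum (λ t → weight S (χ (A t)))                   ≡⟨ weight-∑ S (λ t → χ (A t)) ⟨
      weight S w                                       ≤⟨ weight-mono S (covers M) ⟩
      weight S (λ v → sum λ j → χ (class M j) v)       ≡⟨ weight-∑ S (λ j → χ (class M j)) ⟩
      sum (λ j → weight S (χ (class M j)))             ≤⟨ ∑-≤-const (suc a) (λ j → small (class M j) (independent M j)) ⟩
      pred N * suc a                                   ∎
      where open ≤-Reasoning

  record CliqueCover (S : Subset (n G)) (a : ℕ) : Set where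
    field
      part   : Fin a → Subset (n G)
      clique : ∀ i → IsClique G (part i)
      covers : ∀ v → v ∈ S → ∃ λ i → v ∈ part i

  -- Removing a clique that meets every independent set of size `suc a` lowers the bound by one.
  -- Parts may be empty or overlap.
  cliqueCover : ∀ a S → (∀ A → IsIndependent G A → A ⊆ S → ∣ A ∣ ≤ a) → CliqueCover S a
  cliqueCover zero S α≤ = record
    { part   = λ ()
    ; clique = λ ()
    ; covers = λ v v∈S → contradiction
        (≤-trans (≤-reflexive (sym (∣⁅x⁆∣≡1 v))) (α≤ ⁅ v ⁆ (singleton-independent v) (λ u∈ → subst (_∈ S) (sym (x∈⁅y⁆⇒x≡y v u∈)) v∈S))) λ () }
    where
    singleton-independent : ∀ v → IsIndependent G ⁅ v ⁆
    singleton-independent v x y x∈ y∈ rewrite x∈⁅y⁆⇒x≡y v x∈ | x∈⁅y⁆⇒x≡y v y∈ = irrefl G v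
  cliqueCover (suc a) S α≤ with hitting-clique S a α≤
  ... | K , clique , hits = record
    { part   = λ { zero → K ; (suc i) → CliqueCover.part rest i }
    ; clique = λ { zero → clique ; (suc i) → CliqueCover.clique rest i }
    ; covers = cover }
    where
    rest : CliqueCover (S ∩ ∁ K) a
    rest = cliqueCover a (S ∩ ∁ K) λ A indep A⊆ → s≤s⁻¹ (≤∧≢⇒< (α≤ A indep (p∩q⊆p S (∁ K) ∘ A⊆))
      λ ∣A∣≡ → hits (A , (indep , (p∩q⊆p S (∁ K) ∘ A⊆) , ∣A∣≡) , λ v v∈A v∈K → x∈∁p⇒x∉p (proj₂ (x∈p∩q⁻ S (∁ K) (A⊆ v∈A))) v∈K))
    cover : ∀ v → v ∈ S → _
    cover v v∈S with v ∈? K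
    ... | yes v∈K = zero , v∈K
    ... | no  v∉K = let i , v∈ = CliqueCover.covers rest v (x∈p∩q⁺ (v∈S , x∉p⇒x∈∁p v∉K)) in suc i , v∈

-- The game

override : ∀ {k} {V : Set} → Fin k → V → (Fin k → V) → Fin k → V
override c₀ v P c = if does (c ≟ c₀) then v else P c

override-≡ : ∀ {k} {V : Set} (c : Fin k) (v : V) P → override c v P c ≡ v
override-≡ c v P with c ≟ c
... | yes _  = refl
... | no c≢c = contradiction refl c≢c

override-≢ : ∀ {k} {V : Set} {c c₀ : Fin k} (v : V) P → c ≢ c₀ → override c₀ v P c ≡ P c
override-≢ {c = c} {c₀} v P c≢c₀ with c ≟ c₀
... | yes c≡c₀ = contradiction c≡c₀ c≢c₀
... | no _     = refl

override₂ : ∀ {k} {V : Set} → Fin k → V → Fin k → V → (Fin k → V) → Fin k → V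
override₂ c u d v P = override c u (override d v P)

module _ {k} {V : Set} (c : Fin k) (u : V) (d : Fin k) (v : V) (P : Fin k → V) where

  override₂-fst : override₂ c u d v P c ≡ u
  override₂-fst = override-≡ c u (override d v P)

  override₂-snd : d ≢ c → override₂ c u d v P d ≡ v
  override₂-snd d≢c = trans (override-≢ u (override d v P) d≢c) (override-≡ d v P)

  override₂-other : ∀ {e} → e ≢ c → e ≢ d → override₂ c u d v P e ≡ P e
  override₂-other e≢c e≢d = trans (override-≢ u (override d v P) e≢c) (override-≢ v P e≢d)

exit-edge : ∀ {G} {D : Fin (n G) → Set} → (∀ v → Dec (D v)) → ∀ {u v} → Reach G u v → D u → ¬ D v →
            ∃ λ s → ∃ λ t → D s × ¬ D t × Adj G s t
exit-edge D? here               Du ¬Dv = contradiction Du ¬Dv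
exit-edge D? (there {w = w} uw p) Du ¬Dv with D? w
... | yes Dw = exit-edge D? p Dw ¬Dv
... | no ¬Dw = _ , w , Du , ¬Dw , uw

module Game (G : Graph) where

  private
    V = Fin (n G)

  step? : ∀ u v → Dec (Step G u v)
  step? u v = u ≟ v ⊎-dec adj G u v Bool.≟ true

  Dominated : ∀ {m} → Config G m → V → Set
  Dominated cs v = ∃ λ i → Step G (cs i) v

  dominated⇒CopTurn : ∀ {m} {cs : Config G m} {r} → Dominated cs r → CopTurn G cs r
  dominated⇒CopTurn {cs = cs} {r} (i , step) = copMove (override i r cs) move (inj₁ (i , override-≡ i r cs))
    where
    move : CopsMove G cs (override i r cs)
    move j with j ≟ i
    ... | yes refl = step
    ... | no  _    = inj₁ refl

  -- A dominated robber is caught at once; otherwise the cops move to `cs′`, which dominates every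
  -- vertex he can then reach.
  win-in-two : ∀ {m} (cs : Config G m) →
    (∀ r → ¬ Dominated cs r → ∃ λ cs′ → CopsMove G cs cs′ × ∀ r′ → Step G r r′ → Dominated cs′ r′) →
    CopsWin G m
  win-in-two cs trap = cs , λ r → inj₂ (turn r)
    where
    turn : ∀ r → CopTurn G cs r
    turn r with any? (λ i → step? (cs i) r)
    ... | yes dom = dominated⇒CopTurn dom
    ... | no ¬dom = let cs′ , move , caught = trap r ¬dom in
      copMove cs′ move (inj₂ (robMove λ r′ step → inj₂ (dominated⇒CopTurn (caught r′ step))))

  -- Cops are indexed by the classes of a partition into cliques, with no cop for class l.
  module Partition {k} (f : V → Fin (suc k)) (same : ∀ {u v} → f u ≡ f v → Step G u v) where

    -- `P` assigns a position to every class, and `punchIn l` skips the one for `l`.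
    config : Fin (suc k) → (Fin (suc k) → V) → Config G k
    config l P i = P (punchIn l i)

    dominates : ∀ {l c v u} P → c ≢ l → P c ≡ u → Step G u v → Dominated (config l P) v
    dominates {l} {c} {v} P c≢l refl step =
      punchOut l≢c , subst (λ d → Step G (P d) v) (sym (punchIn-punchOut l≢c)) step
      where
      l≢c : l ≢ c
      l≢c = c≢l ∘ sym

    win-empty-class : ∀ l → V → (∀ v → f v ≢ l) → CopsWin G k
    win-empty-class l v₀ empty = config l P , λ r → inj₂ (dominated⇒CopTurn (dominates P (empty r) refl (guard r)))
      where
      P : Fin (suc k) → V
      P c with any? (λ v → f v ≟ c)
      ... | yes (v , _) = v
      -- Further classes may be empty too; their cops are parked at `v₀`.
      ... | no  _       = v₀
      guard : ∀ r → Step G (P (f r)) r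
      guard r with any? (λ v → f v ≟ f r)
      ... | yes (v , fv≡fr) = same fv≡fr
      ... | no  none        = contradiction (r , refl) none

    -- Each class other than `l` is a clique holding a cop, so an undominated robber is in class
    -- `l`.
    win-class : ∀ l (P : Fin (suc k) → V) → (∀ c → f (P c) ≡ c) →
      (∀ r → f r ≡ l → ¬ Dominated (config l P) r →
        ∃ λ P′ → (∀ c → Step G (P c) (P′ c)) × ∀ r′ → Step G r r′ → Dominated (config l P′) r′) →
      CopsWin G k
    win-class l P fP trap = win-in-two (config l P) λ r ¬dom →
      let P′ , move , caught = trap r (decidable-stable (f r ≟ l) λ fr≢l → ¬dom (dominates P fr≢l refl (same (fP (f r))))) ¬dom
      in config l P′ , (λ i → move (punchIn l i)) , caught

    Transversal : V → V → V → Set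
    Transversal y z b = f y ≢ f z × f z ≢ f b × f y ≢ f b

    transversal? : ∀ y z b → Dec (Transversal y z b)
    transversal? y z b = ¬? (f y ≟ f z) ×-dec ¬? (f z ≟ f b) ×-dec ¬? (f y ≟ f b)

    different-classes : ∀ {u v} → f u ≢ f v → Step G u v → Adj G u v
    different-classes fu≢fv (inj₁ refl) = contradiction refl fu≢fv
    different-classes fu≢fv (inj₂ uv)   = uv

    Transitive : Set
    Transitive = ∀ {y z b} → Transversal y z b → Adj G y z → Adj G z b → Adj G y b

    -- A class, that of `s₁` and `s₂`, with edges to two different other classes; `s₁` and `s₂` may
    -- coincide.
    record Hub : Set where
      field
        x₁ s₁ x₂ s₂ : V
        x₁s₁  : Adj G x₁ s₁
        x₂s₂  : Adj G x₂ s₂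
        s₁∼s₂ : f s₁ ≡ f s₂
        x₁≁s₁ : f x₁ ≢ f s₁
        x₂≁s₂ : f x₂ ≢ f s₂
        x₁≁x₂ : f x₁ ≢ f x₂

    module _ (rep : Fin (suc k) → V) (f-rep : ∀ c → f (rep c) ≡ c) where

      private
        two : V → V → Fin (suc k) → V
        two u v = override₂ (f u) u (f v) v rep

        f-two : ∀ u v c → f (two u v c) ≡ c
        f-two u v c with c ≟ f u
        ... | yes refl = refl
        ... | no  _ with c ≟ f v
        ...   | yes refl = refl
        ...   | no  _    = f-rep c

      -- The cops at y and z shift along the path to z and b; the robber's class and that of z are
      -- then guarded, and an escape into the class of y would close an induced 5-cycle.
      win-transversal-path : Perfect G → ∀ {y z b} → Transversal y z b →
        Adj G y z → Adj G z b → adj G y b ≡ false → CopsWin G k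
      win-transversal-path perfect {y} {z} {b} (y≁z , z≁b , y≁b) yz zb ¬yb =
        win-class (f b) P (f-two y z) λ r fr ¬dom → P′ , move , escape r fr ¬dom
        where
        P P′ : Fin (suc k) → V
        P  = two y z
        -- Indices name cops, not current classes: the cop of class `f y` now stands at `z`, that of
        -- `f z` at `b`.
        P′ = override₂ (f y) z (f z) b rep
        move : ∀ c → Step G (P c) (P′ c)
        move c with c ≟ f y
        ... | yes _ = inj₂ yz
        ... | no  _ with c ≟ f z
        ...   | yes _ = inj₂ zb
        ...   | no  _ = inj₁ refl
        by-z : ∀ {v} → Step G z v → Dominated (config (f b) P′) v
        by-z = dominates P′ y≁b (override₂-fst (f y) z (f z) b rep)
        by-b : ∀ {v} → Step G b v → Dominated (config (f b) P′) v
        by-b = dominates P′ z≁b (override₂-snd (f y) z (f z) b rep (y≁z ∘ sym))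
        escape : ∀ r → f r ≡ f b → ¬ Dominated (config (f b) P) r →
                 ∀ r′ → Step G r r′ → Dominated (config (f b) P′) r′
        escape r fr ¬dom r′ step with f r′ ≟ f y | f r′ ≟ f z | f r′ ≟ f b
        ... | no r′≁y | no r′≁z | no r′≁b = dominates P′ r′≁b
              (override₂-other (f y) z (f z) b rep r′≁y r′≁z) (same (f-rep (f r′)))
        ... | _ | yes r′∼z | _ = by-z (same (sym r′∼z))
        ... | _ | _ | yes r′∼b = by-b (same (sym r′∼b))
        ... | yes r′∼y | no _ | no r′≁b with adj G z r′ in zr′ | adj G b r′ in br′
        ...   | true  | _     = by-z (inj₂ zr′)
        ...   | false | true  = by-b (inj₂ br′)
        -- The cycle is `z`, `y`, `r′`, `r`, `b`. Its chords at `r` are absent because the robber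
        -- was undominated, those at `r′` by the present case.
        ...   | false | false = contradiction (adj-reverse G ¬zr)
                (perfect⇒no-C₅ G perfect {z} {y} {r′} {r} {b} (adj-reverse G yz) yr′
                  (adj-reverse G (different-classes (λ r∼r′ → r′≁b (trans (sym r∼r′) fr)) step)) rb
                  (adj-reverse G zb) zr′ (adj-reverse G br′) (adj-reverse G ¬yb) ¬yr)
          where
          ¬zr : adj G z r ≡ false
          ¬zr = Bool.¬-not λ zr → ¬dom (dominates P z≁b
            (override₂-snd (f y) y (f z) z rep (y≁z ∘ sym)) (inj₂ zr))
          ¬yr : adj G y r ≡ false
          ¬yr = Bool.¬-not λ yr → ¬dom (dominates P y≁b (override₂-fst (f y) y (f z) z rep) (inj₂ yr))
          yr′ : Adj G y r′
          yr′ with same (sym r′∼y)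
          ... | inj₂ adj  = adj
          ... | inj₁ refl = contradiction (trans (sym zr′) (adj-reverse G yz)) λ ()
          rb : Adj G r b
          rb with same fr
          ... | inj₂ adj  = adj
          ... | inj₁ refl = contradiction (trans (sym ¬zr) zb) λ ()

      -- If the robber has a neighbour b in another class, a cop from a hub neighbour outside the
      -- class of b enters the robber's class, and the cop at b covers the class just abandoned.
      win-hub : Transitive → Hub → CopsWin G k
      win-hub transitive hub = win-class (f s₁) P (f-two x₁ x₂) trap
        where
        open Hub hub
        P : Fin (suc k) → V
        P = two x₁ x₂
        Px₁ : P (f x₁) ≡ x₁
        Px₁ = override₂-fst (f x₁) x₁ (f x₂) x₂ rep
        Px₂ : P (f x₂) ≡ x₂
        Px₂ = override₂-snd (f x₁) x₁ (f x₂) x₂ rep (x₁≁x₂ ∘ sym)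
        Trap : V → Set
        Trap r = ∃ λ P′ → (∀ c → Step G (P c) (P′ c)) × ∀ r′ → Step G r r′ → Dominated (config (f s₁) P′) r′
        enter : ∀ {x s r b} → P (f x) ≡ x → Adj G x s → f s ≡ f s₁ → f x ≢ f s₁ → f r ≡ f s₁ →
                Adj G r b → f b ≢ f s₁ → f b ≢ f x → Trap r
        enter {x} {s} {r} {b} Px xs s∼ x≁ r∼ rb b≁ b≁x = P′ , move , escape
          where
          P′ : Fin (suc k) → V
          P′ = override₂ (f x) s (f b) b P
          move : ∀ c → Step G (P c) (P′ c)
          move c with c ≟ f x
          ... | yes refl = inj₂ (subst (λ u → Adj G u s) (sym Px) xs)
          ... | no  _ with c ≟ f b
          ...   | yes refl = same (f-two x₁ x₂ (f b))
          ...   | no  _    = inj₁ refl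
          by-b : ∀ {v} → Step G b v → Dominated (config (f s₁) P′) v
          by-b = dominates P′ b≁ (override₂-snd (f x) s (f b) b P b≁x)
          escape : ∀ r′ → Step G r r′ → Dominated (config (f s₁) P′) r′
          escape r′ step with f r′ ≟ f s₁ | f r′ ≟ f x | f r′ ≟ f b
          ... | yes r′∼ | _ | _ = dominates P′ x≁ (override₂-fst (f x) s (f b) b P) (same (trans s∼ (sym r′∼)))
          ... | _ | _ | yes r′∼b = by-b (same (sym r′∼b))
          ... | no r′≁ | no r′≁x | no r′≁b = dominates P′ r′≁
                (override₂-other (f x) s (f b) b P r′≁x r′≁b) (same (f-two x₁ x₂ (f r′)))
          -- `r′`, `r`, `b` is a path through three classes, so transitivity joins `r′` to `b`.
          ... | no r′≁ | yes r′∼x | no r′≁b = by-b (inj₂ (adj-reverse G (transitive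
                  ((λ r′∼r → r′≁ (trans r′∼r r∼)) , (λ r∼b → b≁ (trans (sym r∼b) r∼)) , r′≁b)
                  (adj-reverse G (different-classes (λ r∼r′ → r′≁ (trans (sym r∼r′) r∼)) step)) rb)))
        trap : ∀ r → f r ≡ f s₁ → ¬ Dominated (config (f s₁) P) r → Trap r
        trap r r∼ ¬dom with any? (λ b → adj G r b Bool.≟ true ×-dec ¬? (f b ≟ f s₁))
        ... | yes (b , rb , b≁) with f b ≟ f x₁
        ...   | no b≁x₁  = enter Px₁ x₁s₁ refl x₁≁s₁ r∼ rb b≁ b≁x₁
        -- The cop of the class of `b` is needed at `b`, so the one at `x₂` enters instead.
        ...   | yes b∼x₁ = enter Px₂ x₂s₂ (sym s₁∼s₂) (λ e → x₂≁s₂ (trans e s₁∼s₂)) r∼ rb b≁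
                             (λ b∼x₂ → x₁≁x₂ (trans (sym b∼x₁) b∼x₂))
        -- The robber cannot leave his class, and any cop inside it dominates all of it.
        trap r r∼ ¬dom | no isolated = override (f x₁) s₁ P , move , escape
          where
          move : ∀ c → Step G (P c) (override (f x₁) s₁ P c)
          move c with c ≟ f x₁
          ... | yes refl = inj₂ x₁s₁
          ... | no  _    = inj₁ refl
          escape : ∀ r′ → Step G r r′ → Dominated (config (f s₁) (override (f x₁) s₁ P)) r′
          escape r′ step = dominates (override (f x₁) s₁ P) x₁≁s₁ (override-≡ (f x₁) s₁ P)
            (same (sym (decidable-stable (f r′ ≟ f s₁) λ r′≁ →
              isolated (r′ , different-classes (λ r∼r′ → r′≁ (trans (sym r∼r′) r∼)) step , r′≁))))

      -- A walk leaving `c₀` enters some class, that of `x`; a walk leaving the union of these two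
      -- reaches a third. Whichever of the two the second edge leaves is the hub.
      hub : Connected G → ∀ c₀ c₁ → c₀ ≢ c₁ → (∀ i → ∃ λ c₂ → c₂ ≢ c₀ × c₂ ≢ i) → Hub
      hub connected c₀ c₁ c₀≢c₁ third with exit-edge {G} (λ v → f v ≟ c₀) (connected (rep c₀) (rep c₁)) (f-rep c₀)
                                    (λ e → c₀≢c₁ (trans (sym e) (f-rep c₁)))
      ... | s , x , s∼ , x≁ , sx with third (f x)
      ...   | c₂ , c₂≢c₀ , c₂≢fx with exit-edge {G} (λ v → f v ≟ c₀ ⊎-dec f v ≟ f x) (connected (rep c₀) (rep c₂))
               (inj₁ (f-rep c₀)) (λ { (inj₁ e) → c₂≢c₀ (trans (sym (f-rep c₂)) e)
                                    ; (inj₂ e) → c₂≢fx (trans (sym (f-rep c₂)) e) })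
      ...     | t , y , inj₁ t∼ , y≁ , ty = record
        { x₁s₁ = adj-reverse G sx ; x₂s₂ = adj-reverse G ty ; s₁∼s₂ = trans s∼ (sym t∼)
        ; x₁≁s₁ = λ e → x≁ (trans e s∼) ; x₂≁s₂ = λ e → y≁ (inj₁ (trans e t∼)) ; x₁≁x₂ = λ e → y≁ (inj₂ (sym e)) }
      ...     | t , y , inj₂ t∼ , y≁ , ty = record
        { x₁s₁ = sx ; x₂s₂ = adj-reverse G ty ; s₁∼s₂ = sym t∼
        ; x₁≁s₁ = λ e → x≁ (trans (sym e) s∼) ; x₂≁s₂ = λ e → y≁ (inj₂ (trans e t∼)) ; x₁≁x₂ = λ e → y≁ (inj₁ (trans (sym e) s∼)) }

-- Combining the cases

third-class : ∀ {k} (i : Fin (3 + k)) → ∃ λ c → c ≢ zero × c ≢ i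
third-class i with i ≟ suc zero
... | yes refl = suc (suc zero) , (λ ()) , (λ ())
... | no i≢1   = suc zero , (λ ()) , i≢1 ∘ sym

cops-win : ∀ G → Connected G → Perfect G → ∀ {k} (f : Fin (n G) → Fin (3 + k)) →
           (∀ {u v} → f u ≡ f v → Step G u v) → Fin (n G) → CopsWin G (2 + k)
cops-win G connected perfect f same v₀ with all? (λ c → any? λ v → f v ≟ c)
... | no ¬surj = let l , empty = ¬∀⟶∃¬ _ _ (λ c → any? λ v → f v ≟ c) ¬surj in
                 Game.Partition.win-empty-class G f same l v₀ λ v fv≡l → empty (v , fv≡l)
... | yes surj with any? (λ y → any? λ z → any? λ b → Game.Partition.transversal? G f same y z b
                    ×-dec adj G y z Bool.≟ true ×-dec adj G z b Bool.≟ true ×-dec adj G y b Bool.≟ false)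
...   | yes (y , z , b , tr , yz , zb , ¬yb) =
        Game.Partition.win-transversal-path G f same (proj₁ ∘ surj) (proj₂ ∘ surj) perfect tr yz zb ¬yb
...   | no none = Game.Partition.win-hub G f same (proj₁ ∘ surj) (proj₂ ∘ surj)
        (λ {y} {z} {b} tr yz zb → Bool.¬-not λ ¬yb → none (y , z , b , tr , yz , zb , ¬yb))
        (Game.Partition.hub G f same (proj₁ ∘ surj) (proj₂ ∘ surj) connected zero (suc zero) (λ ()) third-class)

theorem1p3 : (G : Graph) → Connected G → Perfect G →
    (a : ℕ) → IsIndependenceNumber G a → 4 ≤ a →
    Σ ℕ λ m → m < a × CopsWin G m
theorem1p3 G connected perfect (suc (suc (suc k))) ((S , _ , ∣S∣≡a) , α≤a) _ =
  -- One cop fewer than the `3 + k` cliques of the cover.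
  2 + k , ≤-refl , cops-win G connected perfect f same v₀
  where
  open CliqueCover (cliqueCover G perfect (3 + k) ⊤ λ A indep _ → α≤a A indep)
  f : Fin (n G) → Fin (3 + k)
  f v = proj₁ (covers v ∈⊤)
  same : ∀ {u v} → f u ≡ f v → Step G u v
  same {u} {v} fu≡fv with u ≟ v
  ... | yes u≡v = inj₁ u≡v
  ... | no  u≢v = inj₂ (clique (f v) u v (subst (λ i → u ∈ part i) fu≡fv (proj₂ (covers u ∈⊤))) (proj₂ (covers v ∈⊤)) u≢v)
  v₀ : Fin (n G)
  -- A maximum independent set is non-empty and supplies a vertex.
  v₀ = proj₁ (∑-pos⇒∃ (χ S) (subst (0 <_) (trans (sym ∣S∣≡a) (∣∣≡∑χ S)) (s≤s z≤n)))
theorem1p3 G _ _ (suc zero) _ (s≤s ())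
theorem1p3 G _ _ (suc (suc zero)) _ (s≤s (s≤s ()))
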